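{- There exists a constant $C>1$ such that for every $n \in \mathbb{N}$, \[ s(P_n) \leq C \max_{0 \leq r \leq n} \left| Q^{(r)}(P_n) \right|. \]
   Context: For $n\in\mathbb{N}$, $P_n$ is the path on vertex set $[n]=\{1,\dots,n\}$ with edges $\{i,i+1\}$ for $1\le i\le n-1$. $Q(P_n)$ is the collection of all subsets of $[n]$ that are independent in $P_n$ (i.e. contain no two consecutive integers). For $0\le r\le n$, $Q^{(r)}(P_n)$ is the set of members of $Q(P_n)$ of size $r$. An antichain is a family in which no member is a subset of another member. $s(P_n)$ denotes the maximum size of an antichain contained in $Q(P_n)$. -}

module Defs where

open import Data.Bool using (Bool; true; false; _∧_; not)
open import Data.Nat using (ℕ; zero; suc; _⊔_; _≡ᵇ_)
open import Data.List using (List; []; _∷_; _++_; map; filter; length; foldr; upTo)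
open import Data.Vec using (Vec; []; _∷_)
open import Data.Fin.Subset using (Subset; ∣_∣; _⊆_)
open import Data.List.Membership.Propositional using (_∈_)
open import Data.List.Relation.Unary.Unique.Propositional using (Unique)
open import Relation.Binary.PropositionalEquality using (_≡_)
open import Relation.Nullary.Decidable using (does)
open import Data.Bool.Properties using (T?)

-- A subset of [n] is a Subset n = Vec Bool n; position i (0-based) is vertex i+1.

-- Independence in the path P_n: no two consecutive vertices both present.
independentᵇ : ∀ {n} → Subset n → Bool
independentᵇ [] = true
independentᵇ (x ∷ []) = true
independentᵇ (x ∷ y ∷ v) = not (x ∧ y) ∧ independentᵇ (y ∷ v)

allSubsets : (n : ℕ) → List (Subset n)
allSubsets zero = [] ∷ []
allSubsets (suc n) = map (false ∷_) (allSubsets n) ++ map (true ∷_) (allSubsets n)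

Qr : (n r : ℕ) → List (Subset n)
Qr n r = filter (λ A → T? (independentᵇ A ∧ (∣ A ∣ ≡ᵇ r))) (allSubsets n)

maxLayer : ℕ → ℕ
maxLayer n = foldr _⊔_ 0 (map (λ r → length (Qr n r)) (upTo (suc n)))

-- A family F (a duplicate-free list of subsets) is contained in Q(P_n)
InQ : ∀ {n} → List (Subset n) → Set
InQ {n} F = ∀ A → A ∈ F → independentᵇ A ≡ true

Antichain : ∀ {n} → List (Subset n) → Set
Antichain F = ∀ A B → A ∈ F → B ∈ F → A ⊆ B → A ≡ B

{-# OPTIONS --safe #-}

-- Cut the path into consecutive pairs of vertices. An independent set shows 00, 01 or 10 on each pair. Fix the
-- set S of pairs showing 10: a pair outside S is free to show 00 or 01 unless the next pair lies in S, when it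
-- must show 00. So Q(P_n) is a disjoint union of Boolean cubes indexed by S, of dimension f(S), and each cube
-- splits into a central binomial coefficient, O(2^f / √f), of chains. The cubes with f < s² contribute only
-- exponentially little when n ≥ 16 s², hence an antichain has O(|Q(P_n)| / s) members.
-- Conversely the size of a random independent set has variance at most n, so by Chebyshev half of Q(P_n)
-- lies in O(√n) layers, and the largest layer has at least a constant times |Q(P_n)| / √n members.
module Submission where

open import Defs
open import Data.Bool using (Bool; true; false; _∧_; if_then_else_) renaming (T to IsTrue)
open import Data.Bool.Properties using (T?)
open import Data.Fin using (Fin; zero; suc)
open import Data.Fin.Properties using (injective⇒≤)
open import Data.Fin.Subset using (Subset; ∣_∣; _⊆_)
open import Data.Fin.Subset.Properties using (⊆-refl; s⊆s; out⊆)
open import Data.List using (List; []; _∷_; _++_; map; filter; foldr; length; lookup; concatMap)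
open import Data.List.Properties using (length-map; length-++; filter-++; map-++)
open import Data.List.Membership.Propositional using (_∈_)
open import Data.List.Membership.Propositional.Properties using (∈-map⁺; ∈-lookup; ∈-upTo⁺)
open import Data.List.Relation.Unary.All using (All; []; _∷_)
import Data.List.Relation.Unary.All as All
import Data.List.Relation.Unary.All.Properties as AllP
open import Data.List.Relation.Unary.AllPairs using (AllPairs; []; _∷_)
import Data.List.Relation.Unary.AllPairs as AllPairs
import Data.List.Relation.Unary.AllPairs.Properties as AllPairsP
open import Data.List.Relation.Unary.Any using (Any; here; there; index)
import Data.List.Relation.Unary.Any as Any
import Data.List.Relation.Unary.Any.Properties as AnyP
open import Data.List.Relation.Unary.Unique.Propositional using (Unique)
open import Data.Nat
open import Data.Nat.DivMod using (_/_; _%_; m≡m%n+[m/n]*n; m%n<n)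
open import Data.Nat.ListAction using (sum)
open import Data.Nat.ListAction.Properties using (sum-++)
open import Data.Nat.Properties
open import Data.Nat.Tactic.RingSolver using (solve-∀)
open import Data.Product using (Σ; _×_; _,_; ∃)
open import Data.Sum using (_⊎_; inj₁; inj₂)
open import Data.Vec using ([]; _∷_)
open import Function using (_∘_)
open import Relation.Binary.PropositionalEquality
open import Relation.Nullary using (yes; no; contradiction)

-- Walks and the ballot numbers

-- walks f x counts the ±1 walks of length f from 0 to x; by symmetry the value at -1 is walks f 1.
walks : ℕ → ℕ → ℕ
walks zero zero = 1
walks zero (suc x) = 0
walks (suc f) zero = 2 * walks f 1
walks (suc f) (suc x) = walks f x + walks f (suc (suc x))

-- By reflection, ballot f l, the number of ±1 walks of length f from l that stay nonnegative,
-- is the number of walks from 0 ending in [-l, l + 1].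
ballot : ℕ → ℕ → ℕ
ballot f zero = walks f 0 + walks f 1
ballot f (suc l) = ballot f l + (walks f (suc l) + walks f (suc (suc l)))

ballot-zero : ∀ l → ballot 0 l ≡ 1
ballot-zero zero = refl
ballot-zero (suc l) = trans (+-identityʳ _) (ballot-zero l)

-- A nonnegative walk at 0 can only step up, just as `double` turns a chain of one member into a
-- single chain of two.
ballot-step₀ : ∀ f → ballot (suc f) 0 ≡ ballot f 1
ballot-step₀ f = lemma (walks f 0) (walks f 1) (walks f 2)
  where
  lemma : ∀ a b c → 2 * b + (a + c) ≡ a + b + (b + c)
  lemma = solve-∀

-- The first step of the walk leads from `suc l` to `suc (suc l)` or to `l`. With chain lengths
-- counted less one, this is how `double` splits a chain of at least two members.
ballot-step : ∀ f l → ballot (suc f) (suc l) ≡ ballot f (suc (suc l)) + ballot f l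
ballot-step f zero = lemma (walks f 0) (walks f 1) (walks f 2) (walks f 3)
  where
  lemma : ∀ a b c d → 2 * b + (a + c) + (a + c + (b + d)) ≡ a + b + (b + c) + (c + d) + (a + b)
  lemma = solve-∀
ballot-step f (suc l) = trans (cong (_+ (walks f (suc l) + walks f (3 + l) + (walks f (2 + l) + walks f (4 + l)))) (ballot-step f l)) (lemma (ballot f l) (walks f (suc l)) (walks f (2 + l)) (walks f (3 + l)) (walks f (4 + l)))
  where
  lemma : ∀ h a b c d → h + (a + b) + (b + c) + h + (a + c + (b + d))
                      ≡ h + (a + b) + (b + c) + (c + d) + (h + (a + b))
  lemma = solve-∀

-- `walks f x` is the binomial coefficient of f over (f + x) / 2, or 0 if the parities differ.
-- Neighbouring coefficients have ratio (f - x) / (f + x + 2); the subtraction is moved to the other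
-- side.
walks-ratio : ∀ f x → f * walks f x ≡ x * walks f x + (f + x + 2) * walks f (2 + x)
walks-ratio zero zero = refl
walks-ratio zero (suc x) = sym (cong₂ _+_ (*-zeroʳ x) (*-zeroʳ (suc x + 2)))
walks-ratio (suc f) zero = +-cancelˡ-≡ (f * b) _ _ (begin
    f * b + suc f * (2 * b)                        ≡⟨ cong (_+ suc f * (2 * b)) (walks-ratio f 1) ⟩
    1 * b + (f + 1 + 2) * d + suc f * (2 * b)      ≡⟨ lemma f b d ⟩
    f * b + (suc f + 0 + 2) * (b + d)              ∎)
  where
  open ≡-Reasoning
  b = walks f 1
  d = walks f 3
  lemma : ∀ f b d → 1 * b + (f + 1 + 2) * d + suc f * (2 * b) ≡ f * b + (suc f + 0 + 2) * (b + d)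
  lemma = solve-∀
walks-ratio (suc f) (suc x) = begin
    suc f * (a + c)                                                        ≡⟨ lemma₁ f a c ⟩
    f * a + f * c + (a + c)                                                ≡⟨ cong₂ (λ u v → u + v + (a + c)) (walks-ratio f x) (walks-ratio f (2 + x)) ⟩
    x * a + (f + x + 2) * c + ((2 + x) * c + (f + (2 + x) + 2) * e) + (a + c) ≡⟨ lemma₂ f x a c e ⟩
    suc x * (a + c) + (suc f + suc x + 2) * (c + e)                        ∎
  where
  open ≡-Reasoning
  a = walks f x
  c = walks f (2 + x)
  e = walks f (4 + x)
  lemma₁ : ∀ f a c → suc f * (a + c) ≡ f * a + f * c + (a + c)
  lemma₁ = solve-∀
  lemma₂ : ∀ f x a c e → x * a + (f + x + 2) * c + ((2 + x) * c + (f + (2 + x) + 2) * e) + (a + c)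
         ≡ suc x * (a + c) + (suc f + suc x + 2) * (c + e)
  lemma₂ = solve-∀

-- The recurrence of the central binomial coefficients. Two more steps bring in `walks f 2`, and
-- `walks-ratio` at 0 makes (f + 2) times it equal to `f * walks f 0`.
walks-return : ∀ f → (2 + f) * walks (2 + f) 0 ≡ 4 * (suc f * walks f 0)
walks-return f = begin
    (2 + f) * (2 * (a + c))                  ≡⟨ lemma₁ f a c ⟩
    2 * ((2 + f) * a) + 2 * ((f + 0 + 2) * c) ≡⟨ cong (λ u → 2 * ((2 + f) * a) + 2 * u) (sym (walks-ratio f 0)) ⟩
    2 * ((2 + f) * a) + 2 * (f * a)          ≡⟨ lemma₂ f a ⟩
    4 * (suc f * a)                          ∎
  where
  open ≡-Reasoning
  a = walks f 0
  c = walks f 2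
  lemma₁ : ∀ f a c → (2 + f) * (2 * (a + c)) ≡ 2 * ((2 + f) * a) + 2 * ((f + 0 + 2) * c)
  lemma₁ = solve-∀
  lemma₂ : ∀ f a → 2 * ((2 + f) * a) + 2 * (f * a) ≡ 4 * (suc f * a)
  lemma₂ = solve-∀

m*m≤n*n⇒m≤n : ∀ {m n} → m * m ≤ n * n → m ≤ n
m*m≤n*n⇒m≤n {m} {n} le with m ≤? n
... | yes p = p
... | no ¬p = contradiction le (<⇒≱ (*-mono-< (≰⇒> ¬p) (≰⇒> ¬p)))

-- From f to f + 2 the left side is multiplied by 16 (f + 3)(f + 1) / (f + 2)² according to
-- `walks-return`, the right side by 16.
walks₀-bound : ∀ f → suc f * (walks f 0 * walks f 0) ≤ 2 ^ f * 2 ^ f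
walks₀-bound zero = ≤-refl
walks₀-bound (suc zero) = z≤n
walks₀-bound (suc (suc f)) = *-cancelˡ-≤ ((2 + f) * (2 + f)) (begin
    (2 + f) * (2 + f) * ((3 + f) * (w * w))            ≡⟨ lemma₁ f w ⟩
    (3 + f) * (((2 + f) * w) * ((2 + f) * w))          ≡⟨ cong (λ u → (3 + f) * (u * u)) (walks-return f) ⟩
    (3 + f) * ((4 * (suc f * a)) * (4 * (suc f * a)))  ≡⟨ lemma₂ f a ⟩
    16 * ((3 + f) * suc f) * (suc f * (a * a))         ≤⟨ *-mono-≤ (*-monoʳ-≤ 16 (≤-trans (n≤1+n _) (≤-reflexive (lemma₄ f)))) (walks₀-bound f) ⟩
    16 * ((2 + f) * (2 + f)) * (p * p)                 ≡⟨ lemma₃ f p ⟩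
    (2 + f) * (2 + f) * ((2 * (2 * p)) * (2 * (2 * p))) ∎)
  where
  open ≤-Reasoning
  w = walks (2 + f) 0
  a = walks f 0
  p = 2 ^ f
  lemma₁ : ∀ f w → (2 + f) * (2 + f) * ((3 + f) * (w * w)) ≡ (3 + f) * (((2 + f) * w) * ((2 + f) * w))
  lemma₁ = solve-∀
  lemma₂ : ∀ f a → (3 + f) * ((4 * (suc f * a)) * (4 * (suc f * a))) ≡ 16 * ((3 + f) * suc f) * (suc f * (a * a))
  lemma₂ = solve-∀
  lemma₃ : ∀ f p → 16 * ((2 + f) * (2 + f)) * (p * p) ≡ (2 + f) * (2 + f) * ((2 * (2 * p)) * (2 * (2 * p)))
  lemma₃ = solve-∀
  lemma₄ : ∀ f → suc ((3 + f) * suc f) ≡ (2 + f) * (2 + f)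
  lemma₄ = solve-∀

-- Since `walks (suc f) 0` is `2 * walks f 1`, this is `walks₀-bound` at `suc f` with the factor f +
-- 2 lowered to f + 1.
walks₁-bound : ∀ f → suc f * (walks f 1 * walks f 1) ≤ 2 ^ f * 2 ^ f
walks₁-bound f = *-cancelˡ-≤ 4 (begin
    4 * (suc f * (a * a))           ≡⟨ lemma₁ f a ⟩
    suc f * ((2 * a) * (2 * a))     ≤⟨ *-monoˡ-≤ ((2 * a) * (2 * a)) (n≤1+n (suc f)) ⟩
    (2 + f) * ((2 * a) * (2 * a))   ≤⟨ walks₀-bound (suc f) ⟩
    (2 * p) * (2 * p)               ≡⟨ lemma₂ p ⟩
    4 * (p * p)                     ∎)
  where
  open ≤-Reasoning
  a = walks f 1
  p = 2 ^ f
  lemma₁ : ∀ f a → 4 * (suc f * (a * a)) ≡ suc f * ((2 * a) * (2 * a))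
  lemma₁ = solve-∀
  lemma₂ : ∀ p → (2 * p) * (2 * p) ≡ 4 * (p * p)
  lemma₂ = solve-∀

m≤m² : ∀ m → m ≤ m * m
m≤m² zero = z≤n
m≤m² (suc m) = m≤m*n (suc m) (suc m)

suc-square-bound : ∀ s {f} → s * s ≤ f → suc s * suc s ≤ 4 * suc f
suc-square-bound s {f} s²≤f = begin
    suc s * suc s        ≤⟨ lemma₂ s ⟩
    4 * suc (s * s)      ≤⟨ *-monoʳ-≤ 4 (s≤s s²≤f) ⟩
    4 * suc f            ∎
  where
  open ≤-Reasoning
  lemma₁ : ∀ s → suc s * suc s ≡ s * s + (2 * s + 1)
  lemma₁ = solve-∀
  lemma₃ : ∀ q → q + (2 * q + 1) + (q + 3) ≡ 4 * suc q
  lemma₃ = solve-∀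
  lemma₂ : ∀ s → suc s * suc s ≤ 4 * suc (s * s)
  lemma₂ s = begin
    suc s * suc s                            ≡⟨ lemma₁ s ⟩
    s * s + (2 * s + 1)                      ≤⟨ +-monoʳ-≤ (s * s) (+-monoˡ-≤ 1 (*-monoʳ-≤ 2 (m≤m² s))) ⟩
    s * s + (2 * (s * s) + 1)                ≤⟨ m≤m+n _ (s * s + 3) ⟩
    s * s + (2 * (s * s) + 1) + (s * s + 3)  ≡⟨ lemma₃ (s * s) ⟩
    4 * suc (s * s)                          ∎

-- Takes the square root: s + 1 is at most twice √(f + 1), and the hypothesis says that w is at most
-- p / √(f + 1).
scaled-bound : ∀ s {f} w p → s * s ≤ f → suc f * (w * w) ≤ p * p → suc s * w ≤ 2 * p
scaled-bound s {f} w p s²≤f le = m*m≤n*n⇒m≤n (begin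
    (suc s * w) * (suc s * w)  ≡⟨ lemma₁ s w ⟩
    suc s * suc s * (w * w)    ≤⟨ *-monoˡ-≤ (w * w) (suc-square-bound s s²≤f) ⟩
    4 * suc f * (w * w)        ≡⟨ *-assoc 4 (suc f) (w * w) ⟩
    4 * (suc f * (w * w))      ≤⟨ *-monoʳ-≤ 4 le ⟩
    4 * (p * p)                ≡⟨ lemma₂ p ⟩
    (2 * p) * (2 * p)          ∎)
  where
  open ≤-Reasoning
  lemma₁ : ∀ s w → (suc s * w) * (suc s * w) ≡ suc s * suc s * (w * w)
  lemma₁ = solve-∀
  lemma₂ : ∀ p → 4 * (p * p) ≡ (2 * p) * (2 * p)
  lemma₂ = solve-∀

ballot-bound-large : ∀ s {f} → s * s ≤ f → suc s * ballot f 0 ≤ 4 * 2 ^ f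
ballot-bound-large s {f} s²≤f = begin
    suc s * (walks f 0 + walks f 1)           ≡⟨ *-distribˡ-+ (suc s) (walks f 0) _ ⟩
    suc s * walks f 0 + suc s * walks f 1     ≤⟨ +-mono-≤ (scaled-bound s (walks f 0) (2 ^ f) s²≤f (walks₀-bound f))
                                                          (scaled-bound s (walks f 1) (2 ^ f) s²≤f (walks₁-bound f)) ⟩
    2 * 2 ^ f + 2 * 2 ^ f                     ≡⟨ sym (*-distribʳ-+ (2 ^ f) 2 2) ⟩
    4 * 2 ^ f                                 ∎
  where open ≤-Reasoning

-- The bound has to hold for every f, because cubes of all dimensions get summed. The second summand
-- pays for f below s², where only the bound `4 * 2 ^ f` is available.
ballot-bound : ∀ s f → suc s * ballot f 0 ≤ 4 * 2 ^ f + suc s * (4 * 2 ^ (s * s))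
ballot-bound s f with s * s ≤? f
... | yes s²≤f = ≤-trans (ballot-bound-large s s²≤f) (m≤m+n _ _)
... | no s²≰f = ≤-trans (*-monoʳ-≤ (suc s) (begin
    ballot f 0                ≡⟨ sym (*-identityˡ _) ⟩
    -- At s = 0 the large case holds for every f and gives this trivial bound.
    1 * ballot f 0            ≤⟨ ballot-bound-large 0 {f} z≤n ⟩
    4 * 2 ^ f            ≤⟨ *-monoʳ-≤ 4 (^-monoʳ-≤ 2 (<⇒≤ (≰⇒> s²≰f))) ⟩
    4 * 2 ^ (s * s)      ∎)) (m≤n+m _ (4 * 2 ^ f))
  where open ≤-Reasoning

-- Chain covers of the independent sets

-- Chains are listed from the largest member down.
Chain : ∀ {n} → List (Subset n) → Set
Chain = AllPairs (λ A B → B ⊆ A)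

chain-comparable : ∀ {n} {c : List (Subset n)} → Chain c → ∀ {A B} → A ∈ c → B ∈ c → A ⊆ B ⊎ B ⊆ A
chain-comparable (_ ∷ _) (here refl) (here refl) = inj₁ ⊆-refl
chain-comparable (below ∷ _) (here refl) (there B∈c) = inj₂ (All.lookup below B∈c)
chain-comparable (below ∷ _) (there A∈c) (here refl) = inj₁ (All.lookup below A∈c)
chain-comparable (_ ∷ chain) (there A∈c) (there B∈c) = chain-comparable chain A∈c B∈c

lookup-injective : ∀ {X : Set} {xs : List X} → Unique xs → ∀ {i j} → lookup xs i ≡ lookup xs j → i ≡ j
lookup-injective (_ ∷ _) {zero} {zero} eq = refl
lookup-injective {xs = _ ∷ xs} (fresh ∷ _) {zero} {suc j} eq = contradiction eq (All.lookup fresh (∈-lookup {xs = xs} j))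
lookup-injective {xs = _ ∷ xs} (fresh ∷ _) {suc i} {zero} eq = contradiction (sym eq) (All.lookup fresh (∈-lookup {xs = xs} i))
lookup-injective (_ ∷ unique) {suc i} {suc j} eq = cong suc (lookup-injective unique eq)

-- Pigeonhole: send each member of F to a chain containing it. Two members in one chain are
-- comparable, hence equal, so the map is injective.
antichain-length : ∀ {n} (cs : List (List (Subset n))) → All Chain cs →
  (F : List (Subset n)) → Unique F → Antichain F → (∀ A → A ∈ F → Any (A ∈_) cs) → length F ≤ length cs
antichain-length cs chains F unique antichain cover = injective⇒≤ {f = chainOf} chainOf-injective
  where
  covered : ∀ i → Any (lookup F i ∈_) cs
  covered i = cover (lookup F i) (∈-lookup i)
  chainOf : Fin (length F) → Fin (length cs)
  chainOf i = index (covered i)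
  chainOf-injective : ∀ {i j} → chainOf i ≡ chainOf j → i ≡ j
  chainOf-injective {i} {j} eq = lookup-injective unique same
    where
    A∈ = AnyP.lookup-index (covered i)
    B∈ : lookup F j ∈ lookup cs (chainOf i)
    B∈ = subst (λ c → lookup F j ∈ lookup cs c) (sym eq) (AnyP.lookup-index (covered j))
    same : lookup F i ≡ lookup F j
    same with chain-comparable (All.lookup chains (∈-lookup {xs = cs} (chainOf i))) A∈ B∈
    ... | inj₁ A⊆B = antichain _ _ (∈-lookup i) (∈-lookup j) A⊆B
    ... | inj₂ B⊆A = sym (antichain _ _ (∈-lookup j) (∈-lookup i) B⊆A)

00∷_ 01∷_ 10∷_ : ∀ {n} → Subset n → Subset (2 + n)
00∷ A = false ∷ false ∷ A
01∷ A = false ∷ true ∷ A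
10∷ A = true ∷ false ∷ A

-- The product of a chain with the two-element chain 00 < 01, split into two chains (de Bruijn–Tengbergen–Kruyswijk).
double : ∀ {n} → List (Subset n) → List (List (Subset (2 + n)))
double [] = []
double (A ∷ []) = ((01∷ A) ∷ (00∷ A) ∷ []) ∷ []
double (A ∷ B ∷ c) = ((01∷ A) ∷ map 00∷_ (A ∷ B ∷ c)) ∷ map 01∷_ (B ∷ c) ∷ []

-- chains n b covers the independent sets whose indicator vector starts with b (with b = false for the empty vector).
chains : ∀ n → Bool → List (List (Subset n))
chains zero false = ([] ∷ []) ∷ []
chains zero true = []
-- For odd n one vertex is left over; each of its two values starts a cube of dimension 0.
chains (suc zero) b = ((b ∷ []) ∷ []) ∷ []
-- Before a 1 the pair is forced to be 00; before a 0 it may be 00 or 01, which adds a dimension to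
-- the cube.
chains (suc (suc n)) false = map (map 00∷_) (chains n true) ++ concatMap double (chains n false)
chains (suc (suc n)) true = map (map 10∷_) (chains n true ++ chains n false)

map-chain : ∀ {m n} {f : Subset m → Subset n} → (∀ {A B} → B ⊆ A → f B ⊆ f A) →
            ∀ {c} → Chain c → Chain (map f c)
map-chain mono = AllPairsP.map⁺ ∘ AllPairs.map mono

00-mono : ∀ {n} {A B : Subset n} → B ⊆ A → (00∷ B) ⊆ (00∷ A)
00-mono B⊆A = s⊆s (s⊆s B⊆A)

00⊆01 : ∀ {n} {A B : Subset n} → B ⊆ A → (00∷ B) ⊆ (01∷ A)
00⊆01 B⊆A = s⊆s (out⊆ B⊆A)

double-chains : ∀ {n} {c : List (Subset n)} → Chain c → All Chain (double c)
double-chains [] = []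
double-chains {c = A ∷ []} chain = ((00⊆01 ⊆-refl ∷ []) ∷ [] ∷ []) ∷ []
double-chains {c = A ∷ B ∷ c} chain@(below ∷ rest) =
  (AllP.map⁺ (00⊆01 ⊆-refl ∷ All.map 00⊆01 below) ∷ map-chain 00-mono chain)
  ∷ map-chain (s⊆s ∘ s⊆s) rest ∷ []

chains-chain : ∀ n b → All Chain (chains n b)
chains-chain zero false = ([] ∷ []) ∷ []
chains-chain zero true = []
chains-chain (suc zero) b = ([] ∷ []) ∷ []
chains-chain (suc (suc n)) false = AllP.++⁺ (AllP.map⁺ (All.map (map-chain 00-mono) (chains-chain n true)))
  (AllP.concat⁺ (AllP.map⁺ (All.map double-chains (chains-chain n false))))
chains-chain (suc (suc n)) true = AllP.map⁺ (All.map (map-chain (s⊆s ∘ s⊆s))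
  (AllP.++⁺ (chains-chain n true) (chains-chain n false)))

double-00 : ∀ {n} {A : Subset n} {c} → A ∈ c → Any ((00∷ A) ∈_) (double c)
double-00 {c = _ ∷ []} (here refl) = here (there (here refl))
double-00 {c = _ ∷ _ ∷ _} A∈c = here (there (∈-map⁺ 00∷_ A∈c))

double-01 : ∀ {n} {A : Subset n} {c} → A ∈ c → Any ((01∷ A) ∈_) (double c)
double-01 {c = _ ∷ []} (here refl) = here (here refl)
double-01 {c = _ ∷ _ ∷ _} (here refl) = here (here refl)
double-01 {c = _ ∷ _ ∷ _} (there A∈c) = there (here (∈-map⁺ 01∷_ A∈c))

first : ∀ {n} → Subset n → Bool
first [] = false
first (b ∷ _) = b

independent-tail : ∀ {n} b (A : Subset n) → independentᵇ (b ∷ A) ≡ true → independentᵇ A ≡ true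
independent-tail b [] ind = refl
independent-tail false (_ ∷ _) ind = ind
independent-tail true (false ∷ _) ind = ind

-- Declared ahead of its proof because the two covering statements are mutually recursive: after 10
-- the rest may start with either bit.
chains-cover : ∀ {n} (A : Subset n) → independentᵇ A ≡ true → Any (A ∈_) (chains n true ++ chains n false)

chains-cover-first : ∀ {n} (A : Subset n) → independentᵇ A ≡ true → Any (A ∈_) (chains n (first A))
chains-cover-first [] ind = here (here refl)
chains-cover-first (b ∷ []) ind = here (here refl)
chains-cover-first (true ∷ false ∷ A) ind =
  AnyP.map⁺ (Any.map (∈-map⁺ 10∷_) (chains-cover A (independent-tail false A ind)))
chains-cover-first (false ∷ true ∷ []) ind = here (here refl)
chains-cover-first {suc (suc n)} (false ∷ true ∷ A@(false ∷ _)) ind =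
  AnyP.++⁺ʳ (map (map 00∷_) (chains n true)) (AnyP.concatMap⁺ double (Any.map double-01 (chains-cover-first A ind)))
chains-cover-first (false ∷ false ∷ []) ind = here (there (here refl))
chains-cover-first (false ∷ false ∷ A@(true ∷ _)) ind =
  AnyP.++⁺ˡ (AnyP.map⁺ (Any.map (∈-map⁺ 00∷_) (chains-cover-first A ind)))
chains-cover-first {suc (suc n)} (false ∷ false ∷ A@(false ∷ _)) ind =
  AnyP.++⁺ʳ (map (map 00∷_) (chains n true)) (AnyP.concatMap⁺ double (Any.map double-00 (chains-cover-first A ind)))

chains-cover {n} A ind with first A | chains-cover-first A ind
... | true | covered = AnyP.++⁺ˡ covered
... | false | covered = AnyP.++⁺ʳ (chains n true) covered

-- Counting the chains

-- weight j cs is the number of chains that cs turns into after j further doublings.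
weight : ∀ {n} → ℕ → List (List (Subset n)) → ℕ
weight j cs = sum (map (λ c → ballot j (pred (length c))) cs)

weight-++ : ∀ {n} j (cs ds : List (List (Subset n))) → weight j (cs ++ ds) ≡ weight j cs + weight j ds
weight-++ j cs ds = trans (cong sum (map-++ _ cs ds)) (sum-++ (map _ cs) (map _ ds))

weight-map : ∀ {m n} j (f : Subset m → Subset n) cs → weight j (map (map f) cs) ≡ weight j cs
weight-map j f [] = refl
weight-map j f (c ∷ cs) = cong₂ _+_ (cong (ballot j ∘ pred) (length-map f c)) (weight-map j f cs)

weight-zero : ∀ {n} (cs : List (List (Subset n))) → weight 0 cs ≡ length cs
weight-zero [] = refl
weight-zero (c ∷ cs) = cong₂ _+_ (ballot-zero (pred (length c))) (weight-zero cs)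

-- Equality holds for nonempty chains. The empty chain vanishes under `double`, while `pred` counts
-- it like a chain of one member.
weight-double₁ : ∀ {n} j (c : List (Subset n)) → weight j (double c) ≤ ballot (suc j) (pred (length c))
weight-double₁ j [] = z≤n
weight-double₁ j (A ∷ []) = ≤-reflexive (trans (+-identityʳ _) (sym (ballot-step₀ j)))
weight-double₁ j (A ∷ B ∷ c) = ≤-reflexive (begin
    ballot j (length (map 00∷_ (A ∷ B ∷ c))) + (ballot j (length (map 01∷_ c)) + 0)
      ≡⟨ cong₂ _+_ (cong (ballot j) (length-map 00∷_ (A ∷ B ∷ c))) (trans (+-identityʳ _) (cong (ballot j) (length-map 01∷_ c))) ⟩
    ballot j (2 + length c) + ballot j (length c)
      ≡⟨ sym (ballot-step j (length c)) ⟩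
    ballot (suc j) (suc (length c)) ∎)
  where open ≡-Reasoning

weight-double : ∀ {n} j (cs : List (List (Subset n))) → weight j (concatMap double cs) ≤ weight (suc j) cs
weight-double j [] = z≤n
weight-double j (c ∷ cs) = ≤-trans (≤-reflexive (weight-++ j (double c) (concatMap double cs)))
  (+-mono-≤ (weight-double₁ j c) (weight-double j cs))

fib : ℕ → ℕ
fib zero = 0
fib (suc zero) = 1
fib (suc (suc n)) = fib (suc n) + fib n

-- halfPower n = 2 ^ ⌊ n / 2 ⌋
halfPower : ℕ → ℕ
halfPower zero = 1
halfPower (suc zero) = 1
halfPower (suc (suc n)) = 2 * halfPower n

-- There are fib (fibIndex b n) independent sets of the path on n vertices whose first bit is b.
fibIndex : Bool → ℕ → ℕ
fibIndex false n = suc n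
fibIndex true n = n

base-weight : ∀ s K → (∀ f → s * ballot f 0 ≤ 4 * 2 ^ f + K) →
  ∀ j → s * (ballot j 0 + 0) ≤ 4 * 2 ^ j * 1 + K * 1
base-weight s K bound j = begin
    s * (ballot j 0 + 0)            ≡⟨ cong (s *_) (+-identityʳ _) ⟩
    s * ballot j 0                  ≤⟨ bound j ⟩
    4 * 2 ^ j + K              ≡⟨ sym (cong₂ _+_ (*-identityʳ (4 * 2 ^ j)) (*-identityʳ K)) ⟩
    4 * 2 ^ j * 1 + K * 1      ∎
  where open ≤-Reasoning

-- A cube of dimension f contributes at most 4 * 2 ^ (j + f) + K. The powers 2 ^ f add up to the
-- number of independent sets with first bit b, and K is paid once for each of at most `halfPower n`
-- cubes.
chains-weight : ∀ s K → (∀ f → s * ballot f 0 ≤ 4 * 2 ^ f + K) →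
  ∀ n b j → s * weight j (chains n b) ≤ 4 * 2 ^ j * fib (fibIndex b n) + K * halfPower n
chains-weight s K bound zero false j = base-weight s K bound j
chains-weight s K bound zero true j = ≤-trans (≤-reflexive (*-zeroʳ s)) z≤n
chains-weight s K bound (suc zero) false j = base-weight s K bound j
chains-weight s K bound (suc zero) true j = base-weight s K bound j
chains-weight s K bound (suc (suc n)) false j = begin
    s * weight j (map (map 00∷_) (chains n true) ++ concatMap double (chains n false))
      ≡⟨ cong (s *_) (weight-++ j (map (map 00∷_) (chains n true)) _) ⟩
    s * (weight j (map (map 00∷_) (chains n true)) + weight j (concatMap double (chains n false)))
      ≤⟨ *-monoʳ-≤ s (+-mono-≤ (≤-reflexive (weight-map j 00∷_ (chains n true))) (weight-double j (chains n false))) ⟩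
    s * (weight j (chains n true) + weight (suc j) (chains n false))
      ≡⟨ *-distribˡ-+ s (weight j (chains n true)) _ ⟩
    s * weight j (chains n true) + s * weight (suc j) (chains n false)
      ≤⟨ +-mono-≤ (chains-weight s K bound n true j) (chains-weight s K bound n false (suc j)) ⟩
    4 * 2 ^ j * fib n + K * halfPower n + (4 * (2 * 2 ^ j) * fib (suc n) + K * halfPower n)
      ≡⟨ lemma (2 ^ j) (fib n) (fib (suc n)) K (halfPower n) ⟩
    4 * 2 ^ j * (fib (suc n) + fib n + fib (suc n)) + K * (2 * halfPower n) ∎
  where
  open ≤-Reasoning
  lemma : ∀ p a b K h → 4 * p * a + K * h + (4 * (2 * p) * b + K * h) ≡ 4 * p * (b + a + b) + K * (2 * h)
  lemma = solve-∀
chains-weight s K bound (suc (suc n)) true j = begin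
    s * weight j (map (map 10∷_) (chains n true ++ chains n false))
      ≡⟨ cong (s *_) (trans (weight-map j 10∷_ (chains n true ++ chains n false)) (weight-++ j (chains n true) (chains n false))) ⟩
    s * (weight j (chains n true) + weight j (chains n false))
      ≡⟨ *-distribˡ-+ s (weight j (chains n true)) _ ⟩
    s * weight j (chains n true) + s * weight j (chains n false)
      ≤⟨ +-mono-≤ (chains-weight s K bound n true j) (chains-weight s K bound n false j) ⟩
    4 * 2 ^ j * fib n + K * halfPower n + (4 * 2 ^ j * fib (suc n) + K * halfPower n)
      ≡⟨ lemma (2 ^ j) (fib n) (fib (suc n)) K (halfPower n) ⟩
    4 * 2 ^ j * (fib (suc n) + fib n) + K * (2 * halfPower n) ∎
  where
  open ≤-Reasoning
  lemma : ∀ p a b K h → 4 * p * a + K * h + (4 * p * b + K * h) ≡ 4 * p * (b + a) + K * (2 * h)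
  lemma = solve-∀

chains-number : ∀ s K → (∀ f → s * ballot f 0 ≤ 4 * 2 ^ f + K) →
  ∀ n → s * length (chains n true ++ chains n false) ≤ 4 * fib (2 + n) + 2 * (K * halfPower n)
chains-number s K bound n = begin
    s * length (chains n true ++ chains n false)
      ≡⟨ cong (s *_) (trans (sym (weight-zero (chains n true ++ chains n false))) (weight-++ 0 (chains n true) (chains n false))) ⟩
    s * (weight 0 (chains n true) + weight 0 (chains n false))
      ≡⟨ *-distribˡ-+ s (weight 0 (chains n true)) _ ⟩
    s * weight 0 (chains n true) + s * weight 0 (chains n false)
      ≤⟨ +-mono-≤ (chains-weight s K bound n true 0) (chains-weight s K bound n false 0) ⟩
    4 * fib n + K * halfPower n + (4 * fib (suc n) + K * halfPower n)
      ≡⟨ lemma (fib n) (fib (suc n)) (K * halfPower n) ⟩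
    4 * (fib (suc n) + fib n) + 2 * (K * halfPower n) ∎
  where
  open ≤-Reasoning
  lemma : ∀ a b k → 4 * a + k + (4 * b + k) ≡ 4 * (b + a) + 2 * k
  lemma = solve-∀

halfPower≤fib : ∀ n → halfPower n ≤ fib (2 + n)
halfPower≤fib zero = ≤-refl
halfPower≤fib (suc zero) = s≤s z≤n
halfPower≤fib (suc (suc n)) = begin
    2 * halfPower n                        ≤⟨ *-monoʳ-≤ 2 (halfPower≤fib n) ⟩
    2 * fib (2 + n)                        ≤⟨ m≤m+n (2 * fib (2 + n)) (fib (1 + n)) ⟩
    2 * fib (2 + n) + fib (1 + n)          ≡⟨ lemma (fib (2 + n)) (fib (1 + n)) ⟩
    fib (4 + n)                            ∎
  where
  open ≤-Reasoning
  lemma : ∀ a b → 2 * a + b ≡ a + b + a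
  lemma = solve-∀

-- Unfolding gives fib (9 + n) = 34 fib (1 + n) + 21 fib n. The factor is lowered to 32 to have a
-- power of two.
fib-8 : ∀ n → 32 * fib n ≤ fib (8 + n)
fib-8 zero = z≤n
fib-8 (suc n) = ≤-trans (m≤m+n (32 * fib (suc n)) (2 * fib (suc n) + 21 * fib n)) (≤-reflexive (lemma (fib (suc n)) (fib n)))
  where
  lemma : ∀ b a → 32 * b + (2 * b + 21 * a) ≡
    (let c = b + a; d = c + b; e = d + c; f = e + d; g = f + e; h = g + f; i = h + g in i + h)
  lemma = solve-∀

-- Eight more vertices multiply halfPower by 16 but fib by at least 32, leaving a spare factor 2.
halfPower-slack : ∀ q r → 2 ^ q * halfPower (q * 8 + r) ≤ fib (2 + (q * 8 + r))
halfPower-slack zero r = ≤-trans (≤-reflexive (+-identityʳ _)) (halfPower≤fib r)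
halfPower-slack (suc q) r = begin
    2 * 2 ^ q * (2 * (2 * (2 * (2 * halfPower (q * 8 + r)))))   ≡⟨ lemma (2 ^ q) (halfPower (q * 8 + r)) ⟩
    32 * (2 ^ q * halfPower (q * 8 + r))                        ≤⟨ *-monoʳ-≤ 32 (halfPower-slack q r) ⟩
    32 * fib (2 + (q * 8 + r))                                  ≤⟨ fib-8 (2 + (q * 8 + r)) ⟩
    fib (8 + (2 + (q * 8 + r)))                                 ∎
  where
  open ≤-Reasoning
  lemma : ∀ p h → 2 * p * (2 * (2 * (2 * (2 * h)))) ≡ 32 * (p * h)
  lemma = solve-∀

suc≤2^ : ∀ s → suc s ≤ 2 ^ s
suc≤2^ zero = ≤-refl
suc≤2^ (suc s) = ≤-trans (≤-trans (+-monoʳ-≤ 1 (suc≤2^ s)) (+-monoˡ-≤ (2 ^ s) (≤-trans (s≤s z≤n) (suc≤2^ s))))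
  (≤-reflexive (cong (2 ^ s +_) (sym (+-identityʳ _))))

-- The path contains q = 2 s² blocks of eight vertices, whence 16 s². Their slack 2 ^ q absorbs both
-- `2 ^ (s * s)` and s + 1, which is at most 2 ^ s.
error-bound : ∀ s n → 16 * (s * s) ≤ n → suc s * 2 ^ (s * s) * halfPower n ≤ fib (2 + n)
error-bound s n le = begin
    suc s * 2 ^ (s * s) * halfPower n      ≤⟨ *-monoˡ-≤ (halfPower n) (begin
        suc s * 2 ^ (s * s)                  ≤⟨ *-monoˡ-≤ (2 ^ (s * s)) (≤-trans (suc≤2^ s) (^-monoʳ-≤ 2 (m≤m² s))) ⟩
        2 ^ (s * s) * 2 ^ (s * s)            ≡⟨ sym (^-distribˡ-+-* 2 (s * s) (s * s)) ⟩
        2 ^ q                                ∎) ⟩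
    2 ^ q * halfPower n                    ≡⟨ cong (λ u → 2 ^ q * halfPower u) (sym n≡) ⟩
    2 ^ q * halfPower (q * 8 + r)          ≤⟨ halfPower-slack q r ⟩
    fib (2 + (q * 8 + r))                  ≡⟨ cong (λ u → fib (2 + u)) n≡ ⟩
    fib (2 + n)                            ∎
  where
  open ≤-Reasoning
  q = s * s + s * s
  lemma : ∀ a → 16 * a ≡ (a + a) * 8
  lemma = solve-∀
  r = n ∸ q * 8
  n≡ : q * 8 + r ≡ n
  n≡ = m+[n∸m]≡n (≤-trans (≤-reflexive (sym (lemma (s * s)))) le)

antichain-bound : ∀ s n → 16 * (s * s) ≤ n → (F : List (Subset n)) → Unique F → InQ F → Antichain F →
  suc s * length F ≤ 12 * fib (2 + n)
antichain-bound s n le F unique inQ antichain = begin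
    suc s * length F
      ≤⟨ *-monoʳ-≤ (suc s) (antichain-length (chains n true ++ chains n false)
           (AllP.++⁺ (chains-chain n true) (chains-chain n false)) F unique antichain
           (λ A A∈F → chains-cover A (inQ A A∈F))) ⟩
    suc s * length (chains n true ++ chains n false)
      ≤⟨ chains-number (suc s) (suc s * (4 * 2 ^ (s * s))) (ballot-bound s) n ⟩
    4 * fib (2 + n) + 2 * (suc s * (4 * 2 ^ (s * s)) * halfPower n)
      ≡⟨ cong (4 * fib (2 + n) +_) (lemma₁ s (2 ^ (s * s)) (halfPower n)) ⟩
    4 * fib (2 + n) + 8 * (suc s * 2 ^ (s * s) * halfPower n)
      ≤⟨ +-monoʳ-≤ (4 * fib (2 + n)) (*-monoʳ-≤ 8 (error-bound s n le)) ⟩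
    -- The 8 is the constant 4 of the small cubes, once for each value of the first bit.
    4 * fib (2 + n) + 8 * fib (2 + n)
      ≡⟨ sym (*-distribʳ-+ (fib (2 + n)) 4 8) ⟩
    12 * fib (2 + n) ∎
  where
  open ≤-Reasoning
  lemma₁ : ∀ s p h → 2 * (suc s * (4 * p) * h) ≡ 8 * (suc s * p * h)
  lemma₁ = solve-∀

-- The distribution of the sizes of independent sets

-- sizeSum n φ is the sum of φ ∣ A ∣ over the independent sets A of the path on n vertices, which start with 0 or with 10.
sizeSum : ℕ → (ℕ → ℕ) → ℕ
sizeSum zero φ = φ 0
sizeSum (suc zero) φ = φ 0 + φ 1
sizeSum (suc (suc n)) φ = sizeSum (suc n) φ + sizeSum n (φ ∘ suc)

sizeSum-mono : ∀ n {φ ψ : ℕ → ℕ} → (∀ k → φ k ≤ ψ k) → sizeSum n φ ≤ sizeSum n ψ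
sizeSum-mono zero le = le 0
sizeSum-mono (suc zero) le = +-mono-≤ (le 0) (le 1)
sizeSum-mono (suc (suc n)) le = +-mono-≤ (sizeSum-mono (suc n) le) (sizeSum-mono n (le ∘ suc))

sizeSum-cong : ∀ n {φ ψ : ℕ → ℕ} → (∀ k → φ k ≡ ψ k) → sizeSum n φ ≡ sizeSum n ψ
sizeSum-cong n eq = ≤-antisym (sizeSum-mono n (≤-reflexive ∘ eq)) (sizeSum-mono n (≤-reflexive ∘ sym ∘ eq))

interchange : ∀ a b c d → (a + b) + (c + d) ≡ (a + c) + (b + d)
interchange = solve-∀

sizeSum-+ : ∀ n (φ ψ : ℕ → ℕ) → sizeSum n (λ k → φ k + ψ k) ≡ sizeSum n φ + sizeSum n ψ
sizeSum-+ zero φ ψ = refl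
sizeSum-+ (suc zero) φ ψ = interchange (φ 0) (ψ 0) (φ 1) (ψ 1)
sizeSum-+ (suc (suc n)) φ ψ = trans (cong₂ _+_ (sizeSum-+ (suc n) φ ψ) (sizeSum-+ n (φ ∘ suc) (ψ ∘ suc)))
  (interchange (sizeSum (suc n) φ) (sizeSum (suc n) ψ) (sizeSum n (φ ∘ suc)) (sizeSum n (ψ ∘ suc)))

sizeSum-* : ∀ n c (φ : ℕ → ℕ) → sizeSum n (λ k → c * φ k) ≡ c * sizeSum n φ
sizeSum-* zero c φ = refl
sizeSum-* (suc zero) c φ = sym (*-distribˡ-+ c (φ 0) (φ 1))
sizeSum-* (suc (suc n)) c φ = trans (cong₂ _+_ (sizeSum-* (suc n) c φ) (sizeSum-* n c (φ ∘ suc)))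
  (sym (*-distribˡ-+ c (sizeSum (suc n) φ) (sizeSum n (φ ∘ suc))))

sizeSum-vanish : ∀ n (φ : ℕ → ℕ) → (∀ k → k ≤ n → φ k ≡ 0) → sizeSum n φ ≡ 0
sizeSum-vanish zero φ eq = eq 0 z≤n
sizeSum-vanish (suc zero) φ eq = cong₂ _+_ (eq 0 z≤n) (eq 1 ≤-refl)
sizeSum-vanish (suc (suc n)) φ eq = cong₂ _+_
  (sizeSum-vanish (suc n) φ (λ k le → eq k (m≤n⇒m≤1+n le)))
  (sizeSum-vanish n (φ ∘ suc) (λ k le → eq (suc k) (s≤s (m≤n⇒m≤1+n le))))

indicator : Bool → ℕ
indicator b = if b then 1 else 0

countᵇ : ∀ {A : Set} → (A → Bool) → List A → ℕ
countᵇ p xs = length (filter (T? ∘ p) xs)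

countᵇ-∷ : ∀ {A : Set} (p : A → Bool) x xs → countᵇ p (x ∷ xs) ≡ indicator (p x) + countᵇ p xs
countᵇ-∷ p x xs with p x
... | true = refl
... | false = refl

countᵇ-++ : ∀ {A : Set} (p : A → Bool) xs ys → countᵇ p (xs ++ ys) ≡ countᵇ p xs + countᵇ p ys
countᵇ-++ p xs ys = trans (cong length (filter-++ (T? ∘ p) xs ys)) (length-++ (filter (T? ∘ p) xs))

countᵇ-map : ∀ {A B : Set} (p : B → Bool) (q : A → Bool) (f : A → B) → (∀ x → p (f x) ≡ q x) →
             ∀ xs → countᵇ p (map f xs) ≡ countᵇ q xs
countᵇ-map p q f eq [] = refl
countᵇ-map p q f eq (x ∷ xs) = begin
    countᵇ p (f x ∷ map f xs)                     ≡⟨ countᵇ-∷ p (f x) (map f xs) ⟩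
    indicator (p (f x)) + countᵇ p (map f xs)     ≡⟨ cong₂ (λ b m → indicator b + m) (eq x) (countᵇ-map p q f eq xs) ⟩
    indicator (q x) + countᵇ q xs                 ≡⟨ sym (countᵇ-∷ q x xs) ⟩
    countᵇ q (x ∷ xs)                             ∎
  where open ≡-Reasoning

countᵇ-none : ∀ {A : Set} (xs : List A) → countᵇ (λ _ → false) xs ≡ 0
countᵇ-none [] = refl
countᵇ-none (x ∷ xs) = countᵇ-none xs

independent-false∷ : ∀ {n} (v : Subset n) → independentᵇ (false ∷ v) ≡ independentᵇ v
independent-false∷ [] = refl
independent-false∷ (x ∷ v) = refl

-- `allSubsets` branches on one bit, `sizeSum` on 0 or 10. So the half starting with 1 is split once
-- more: 10 gives the second recursive term and 11 gives nothing.
countᵇ-independent : ∀ n (p : ℕ → Bool) →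
  countᵇ (λ A → independentᵇ A ∧ p ∣ A ∣) (allSubsets n) ≡ sizeSum n (indicator ∘ p)
countᵇ-independent zero p = trans (countᵇ-∷ (λ (A : Subset 0) → independentᵇ A ∧ p ∣ A ∣) [] []) (+-identityʳ _)
countᵇ-independent (suc zero) p = trans (countᵇ-∷ q (false ∷ []) ((true ∷ []) ∷ []))
  (cong (indicator (p 0) +_) (trans (countᵇ-∷ q (true ∷ []) []) (+-identityʳ _)))
  where
  q : Subset 1 → Bool
  q A = independentᵇ A ∧ p ∣ A ∣
countᵇ-independent (suc (suc n)) p = begin
    countᵇ q (map (false ∷_) As ++ map (true ∷_) As)                ≡⟨ countᵇ-++ q (map (false ∷_) As) _ ⟩
    countᵇ q (map (false ∷_) As) + countᵇ q (map (true ∷_) As)      ≡⟨ cong₂ _+_ (left (countᵇ-independent (suc n) p)) (right (countᵇ-independent n (p ∘ suc))) ⟩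
    sizeSum (suc n) (indicator ∘ p) + sizeSum n (indicator ∘ p ∘ suc) ∎
  where
  open ≡-Reasoning
  As = allSubsets (suc n)
  Bs = allSubsets n
  q : Subset (suc (suc n)) → Bool
  q A = independentᵇ A ∧ p ∣ A ∣
  q₀ : Subset (suc n) → Bool
  q₀ A = independentᵇ A ∧ p ∣ A ∣
  q₁ : Subset (suc n) → Bool
  q₁ A = q (true ∷ A)
  q₂ : Subset n → Bool
  q₂ A = independentᵇ A ∧ p (suc ∣ A ∣)
  left : countᵇ q₀ As ≡ sizeSum (suc n) (indicator ∘ p) →
         countᵇ q (map (false ∷_) As) ≡ sizeSum (suc n) (indicator ∘ p)
  left ih = trans (countᵇ-map q q₀ (false ∷_) (λ A → cong (_∧ p ∣ A ∣) (independent-false∷ A)) As) ih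
  right : countᵇ q₂ Bs ≡ sizeSum n (indicator ∘ p ∘ suc) →
          countᵇ q (map (true ∷_) As) ≡ sizeSum n (indicator ∘ p ∘ suc)
  right ih = begin
    countᵇ q (map (true ∷_) As)                                    ≡⟨ countᵇ-map q q₁ (true ∷_) (λ _ → refl) As ⟩
    countᵇ q₁ (map (false ∷_) Bs ++ map (true ∷_) Bs)              ≡⟨ countᵇ-++ q₁ (map (false ∷_) Bs) _ ⟩
    countᵇ q₁ (map (false ∷_) Bs) + countᵇ q₁ (map (true ∷_) Bs)   ≡⟨ cong₂ _+_
        (trans (countᵇ-map q₁ q₂ (false ∷_) (λ A → cong (_∧ p (suc ∣ A ∣)) (independent-false∷ A)) Bs) ih)
        (trans (countᵇ-map q₁ (λ _ → false) (true ∷_) (λ _ → refl) Bs) (countᵇ-none Bs)) ⟩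
    sizeSum n (indicator ∘ p ∘ suc) + 0                            ≡⟨ +-identityʳ _ ⟩
    sizeSum n (indicator ∘ p ∘ suc)                                ∎

≤-foldr-⊔ : ∀ {x} xs → x ∈ xs → x ≤ foldr _⊔_ 0 xs
≤-foldr-⊔ (y ∷ xs) (here refl) = m≤m⊔n y _
≤-foldr-⊔ (y ∷ xs) (there x∈xs) = ≤-trans (≤-foldr-⊔ xs x∈xs) (m≤n⊔m y _)

≢⇒≡ᵇ-false : ∀ {k r} → k ≢ r → (k ≡ᵇ r) ≡ false
≢⇒≡ᵇ-false {k} {r} k≢r with k ≡ᵇ r in eq
... | false = refl
... | true = contradiction (≡ᵇ⇒≡ k r (subst IsTrue (sym eq) _)) k≢r

-- Stated for all r because a window of layers around the mean may reach beyond n, where the layers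
-- are empty.
layer≤maxLayer : ∀ n r → sizeSum n (λ k → indicator (k ≡ᵇ r)) ≤ maxLayer n
layer≤maxLayer n r with r ≤? n
... | yes r≤n = begin
    sizeSum n (λ k → indicator (k ≡ᵇ r)) ≡⟨ sym (countᵇ-independent n (_≡ᵇ r)) ⟩
    length (Qr n r)                      ≤⟨ ≤-foldr-⊔ _ (∈-map⁺ (length ∘ Qr n) (∈-upTo⁺ (s≤s r≤n))) ⟩
    maxLayer n                           ∎
  where open ≤-Reasoning
... | no r≰n = ≤-trans (≤-reflexive (sizeSum-vanish n _
    (λ k k≤n → cong indicator (≢⇒≡ᵇ-false {k} {r} (λ { refl → r≰n k≤n }))))) z≤n

-- Mean and variance of the size

total : ℕ → ℕ
total n = sizeSum n (λ _ → 1)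

moment₁ : ℕ → ℕ
moment₁ n = sizeSum n (λ k → k)

moment₂ : ℕ → ℕ
moment₂ n = sizeSum n (λ k → k * k)

moment₁-shift : ∀ n → sizeSum n suc ≡ moment₁ n + total n
moment₁-shift n = trans (sizeSum-cong n (λ k → +-comm 1 k)) (sizeSum-+ n (λ k → k) (λ _ → 1))

moment₂-shift : ∀ n → sizeSum n (λ k → suc k * suc k) ≡ moment₂ n + (2 * moment₁ n + total n)
moment₂-shift n = begin
    sizeSum n (λ k → suc k * suc k)              ≡⟨ sizeSum-cong n square-suc ⟩
    sizeSum n (λ k → k * k + (2 * k + 1))        ≡⟨ sizeSum-+ n (λ k → k * k) (λ k → 2 * k + 1) ⟩
    moment₂ n + sizeSum n (λ k → 2 * k + 1)      ≡⟨ cong (moment₂ n +_) (sizeSum-+ n (λ k → 2 * k) (λ _ → 1)) ⟩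
    moment₂ n + (sizeSum n (λ k → 2 * k) + total n) ≡⟨ cong (λ u → moment₂ n + (u + total n)) (sizeSum-* n 2 (λ k → k)) ⟩
    moment₂ n + (2 * moment₁ n + total n)        ∎
  where
  open ≡-Reasoning
  square-suc : ∀ k → suc k * suc k ≡ k * k + (2 * k + 1)
  square-suc = solve-∀

total-positive : ∀ n → 1 ≤ total n
total-positive zero = ≤-refl
total-positive (suc zero) = s≤s z≤n
total-positive (suc (suc n)) = ≤-trans (total-positive (suc n)) (m≤m+n _ _)

-- The mean size moment₁ n / total n grows by at most 1 when a vertex is added.
-- The gap g obeys gₙ₊₁ = total n * total (suc n) ∸ gₙ, so the complement e at n is the gap at suc n.
MeanGap : ℕ → Set
MeanGap n = ∃ λ g → ∃ λ e →
  (total n * moment₁ (suc n) ≡ total (suc n) * moment₁ n + g) × (g + e ≡ total n * total (suc n))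

-- In `T₁ * (M₁ + (M₀ + T₀)) - (T₁ + T₀) * M₁` the products `T₁ * M₁` cancel, which leaves
-- `T₀ * T₁ - g`, that is `e`.
meanGap : ∀ n → MeanGap n
meanGap zero = 1 , 1 , refl , refl
meanGap (suc n) with meanGap n
... | g , e , eq , g+e≡ = e , e′ , +-cancelʳ-≡ (T₁ * M₀ + g) _ _ (begin
      T₁ * (M₁ + sizeSum n suc) + (T₁ * M₀ + g)   ≡⟨ cong₂ (λ u v → T₁ * (M₁ + u) + v) (moment₁-shift n) (sym eq) ⟩
      T₁ * (M₁ + (M₀ + T₀)) + T₀ * M₁             ≡⟨ lemma₁ T₀ T₁ M₀ M₁ ⟩
      (T₁ + T₀) * M₁ + T₁ * M₀ + T₀ * T₁          ≡⟨ cong ((T₁ + T₀) * M₁ + T₁ * M₀ +_) (sym g+e≡) ⟩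
      (T₁ + T₀) * M₁ + T₁ * M₀ + (g + e)          ≡⟨ lemma₂ ((T₁ + T₀) * M₁) (T₁ * M₀) g e ⟩
      (T₁ + T₀) * M₁ + e + (T₁ * M₀ + g)          ∎) , m+[n∸m]≡n e≤
  where
  open ≡-Reasoning
  T₀ = total n
  T₁ = total (suc n)
  M₀ = moment₁ n
  M₁ = moment₁ (suc n)
  e≤ : e ≤ T₁ * (T₁ + T₀)
  e≤ = ≤-trans (m≤n+m e g) (≤-trans (≤-reflexive (trans g+e≡ (*-comm T₀ T₁))) (*-monoʳ-≤ T₁ (m≤n+m T₀ T₁)))
  e′ = T₁ * (T₁ + T₀) ∸ e
  lemma₁ : ∀ T₀ T₁ M₀ M₁ → T₁ * (M₁ + (M₀ + T₀)) + T₀ * M₁ ≡ (T₁ + T₀) * M₁ + T₁ * M₀ + T₀ * T₁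
  lemma₁ = solve-∀
  lemma₂ : ∀ a b g e → a + b + (g + e) ≡ a + e + (b + g)
  lemma₂ = solve-∀

-- Law of total variance for two merged samples with counts Tᵢ, sums Mᵢ and square sums Sᵢ whose means
-- differ by at most 1, with all denominators cleared.
merged-variance : ∀ T₀ T₁ M₀ M₁ S₀ S₁ e c → 1 ≤ T₀ → 1 ≤ T₁ →
  T₀ * M₁ + e ≡ T₁ * M₀ → e ≤ T₁ * T₀ →
  T₁ * S₁ ≤ M₁ * M₁ + c * (T₁ * T₁) → T₀ * S₀ ≤ M₀ * M₀ + c * (T₀ * T₀) →
  (T₁ + T₀) * (S₁ + S₀) ≤ (M₁ + M₀) * (M₁ + M₀) + suc c * ((T₁ + T₀) * (T₁ + T₀))
merged-variance T₀@(suc _) T₁@(suc _) M₀ M₁ S₀ S₁ e c _ _ eq e≤ v₁ v₀ = *-cancelˡ-≤ (T₁ * T₀) (begin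
    T₁ * T₀ * ((T₁ + T₀) * (S₁ + S₀))
      ≡⟨ lemma₁ T₀ T₁ S₀ S₁ ⟩
    (T₁ + T₀) * (T₀ * (T₁ * S₁) + T₁ * (T₀ * S₀))
      ≤⟨ *-monoʳ-≤ (T₁ + T₀) (+-mono-≤ (*-monoʳ-≤ T₀ v₁) (*-monoʳ-≤ T₁ v₀)) ⟩
    (T₁ + T₀) * (T₀ * (M₁ * M₁ + c * (T₁ * T₁)) + T₁ * (M₀ * M₀ + c * (T₀ * T₀)))
      ≡⟨ lemma₂ T₀ T₁ M₀ M₁ c ⟩
    (T₀ * M₁) * (T₀ * M₁) + (T₁ * M₀) * (T₁ * M₀) + R
      ≡⟨ cong (_+ R) (cong (λ u → (T₀ * M₁) * (T₀ * M₁) + u * u) (sym eq)) ⟩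
    (T₀ * M₁) * (T₀ * M₁) + (T₀ * M₁ + e) * (T₀ * M₁ + e) + R
      ≡⟨ cong (_+ R) (lemma₃ (T₀ * M₁) e) ⟩
    2 * (T₀ * M₁) * (T₀ * M₁ + e) + e * e + R
      -- `e * e` is the variance between the samples. After division by `T₁ * T₀` it is at most the
      -- square of `T₁ + T₀`, which raises c to `suc c`.
      ≤⟨ +-monoˡ-≤ R (+-monoʳ-≤ (2 * (T₀ * M₁) * (T₀ * M₁ + e)) (*-mono-≤ e≤ (≤-trans e≤ TT≤))) ⟩
    2 * (T₀ * M₁) * (T₀ * M₁ + e) + T₁ * T₀ * ((T₁ + T₀) * (T₁ + T₀)) + R
      ≡⟨ cong (λ u → 2 * (T₀ * M₁) * u + T₁ * T₀ * ((T₁ + T₀) * (T₁ + T₀)) + R) eq ⟩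
    2 * (T₀ * M₁) * (T₁ * M₀) + T₁ * T₀ * ((T₁ + T₀) * (T₁ + T₀)) + R
      ≡⟨ lemma₄ T₀ T₁ M₀ M₁ c ⟩
    T₁ * T₀ * ((M₁ + M₀) * (M₁ + M₀) + suc c * ((T₁ + T₀) * (T₁ + T₀))) ∎)
  where
  open ≤-Reasoning
  R = T₁ * T₀ * (M₁ * M₁ + M₀ * M₀) + c * (T₁ * T₀ * ((T₁ + T₀) * (T₁ + T₀)))
  TT≤ : T₁ * T₀ ≤ (T₁ + T₀) * (T₁ + T₀)
  TT≤ = *-mono-≤ (m≤m+n T₁ T₀) (m≤n+m T₀ T₁)
  lemma₁ : ∀ T₀ T₁ S₀ S₁ → T₁ * T₀ * ((T₁ + T₀) * (S₁ + S₀)) ≡ (T₁ + T₀) * (T₀ * (T₁ * S₁) + T₁ * (T₀ * S₀))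
  lemma₁ = solve-∀
  lemma₂ : ∀ T₀ T₁ M₀ M₁ c → (T₁ + T₀) * (T₀ * (M₁ * M₁ + c * (T₁ * T₁)) + T₁ * (M₀ * M₀ + c * (T₀ * T₀)))
    ≡ (T₀ * M₁) * (T₀ * M₁) + (T₁ * M₀) * (T₁ * M₀)
      + (T₁ * T₀ * (M₁ * M₁ + M₀ * M₀) + c * (T₁ * T₀ * ((T₁ + T₀) * (T₁ + T₀))))
  lemma₂ = solve-∀
  lemma₃ : ∀ x e → x * x + (x + e) * (x + e) ≡ 2 * x * (x + e) + e * e
  lemma₃ = solve-∀
  lemma₄ : ∀ T₀ T₁ M₀ M₁ c → 2 * (T₀ * M₁) * (T₁ * M₀) + T₁ * T₀ * ((T₁ + T₀) * (T₁ + T₀))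
      + (T₁ * T₀ * (M₁ * M₁ + M₀ * M₀) + c * (T₁ * T₀ * ((T₁ + T₀) * (T₁ + T₀))))
    ≡ T₁ * T₀ * ((M₁ + M₀) * (M₁ + M₀) + suc c * ((T₁ + T₀) * (T₁ + T₀)))
  lemma₄ = solve-∀

-- The size of a uniformly random independent set has variance at most n, multiplied through by the
-- square of `total n`.
VarianceBound : ℕ → Set
VarianceBound n = total n * moment₂ n ≤ moment₁ n * moment₁ n + n * (total n * total n)

-- The samples are the sets starting with 0 and those starting with 10. The latter have sizes
-- shifted by 1, which keeps their variance; their mean exceeds the other by `e / (T₀ * T₁)`,
-- between 0 and 1 by `meanGap`.
variance-step : ∀ n → VarianceBound n → VarianceBound (suc n) → VarianceBound (2 + n)
variance-step n v₀ v₁ with meanGap n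
... | g , e , eq , g+e≡ = merged-variance T₀ T₁ (sizeSum n suc) M₁ (sizeSum n (λ k → suc k * suc k)) S₁ e (suc n)
    (total-positive n) (total-positive (suc n)) gap
    (≤-trans (m≤n+m e g) (≤-reflexive (trans g+e≡ (*-comm T₀ T₁))))
    v₁ shifted
  where
  T₀ = total n
  T₁ = total (suc n)
  M₀ = moment₁ n
  M₁ = moment₁ (suc n)
  S₀ = moment₂ n
  S₁ = moment₂ (suc n)
  gap : T₀ * M₁ + e ≡ T₁ * sizeSum n suc
  gap = begin
    T₀ * M₁ + e          ≡⟨ cong (_+ e) eq ⟩
    T₁ * M₀ + g + e      ≡⟨ +-assoc (T₁ * M₀) g e ⟩
    T₁ * M₀ + (g + e)    ≡⟨ cong (T₁ * M₀ +_) (trans g+e≡ (*-comm T₀ T₁)) ⟩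
    T₁ * M₀ + T₁ * T₀    ≡⟨ sym (*-distribˡ-+ T₁ M₀ T₀) ⟩
    T₁ * (M₀ + T₀)       ≡⟨ cong (T₁ *_) (sym (moment₁-shift n)) ⟩
    T₁ * sizeSum n suc   ∎
    where open ≡-Reasoning
  lemma₁ : ∀ T M S → T * (S + (2 * M + T)) ≡ T * S + (2 * M * T + T * T)
  lemma₁ = solve-∀
  lemma₂ : ∀ T M n → M * M + n * (T * T) + (2 * M * T + T * T) ≡ (M + T) * (M + T) + n * (T * T)
  lemma₂ = solve-∀
  shifted : T₀ * sizeSum n (λ k → suc k * suc k) ≤ sizeSum n suc * sizeSum n suc + suc n * (T₀ * T₀)
  shifted = begin
    T₀ * sizeSum n (λ k → suc k * suc k)                    ≡⟨ cong (T₀ *_) (moment₂-shift n) ⟩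
    T₀ * (S₀ + (2 * M₀ + T₀))                               ≡⟨ lemma₁ T₀ M₀ S₀ ⟩
    T₀ * S₀ + (2 * M₀ * T₀ + T₀ * T₀)                       ≤⟨ +-monoˡ-≤ _ v₀ ⟩
    M₀ * M₀ + n * (T₀ * T₀) + (2 * M₀ * T₀ + T₀ * T₀)       ≡⟨ lemma₂ T₀ M₀ n ⟩
    (M₀ + T₀) * (M₀ + T₀) + n * (T₀ * T₀)                   ≤⟨ +-monoʳ-≤ ((M₀ + T₀) * (M₀ + T₀)) (*-monoˡ-≤ (T₀ * T₀) (n≤1+n n)) ⟩
    (M₀ + T₀) * (M₀ + T₀) + suc n * (T₀ * T₀)               ≡⟨ cong (λ u → u * u + suc n * (T₀ * T₀)) (sym (moment₁-shift n)) ⟩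
    sizeSum n suc * sizeSum n suc + suc n * (T₀ * T₀)       ∎
    where open ≤-Reasoning

variance-bound : ∀ n → VarianceBound n
variance-bound zero = z≤n
variance-bound (suc zero) = s≤s (s≤s z≤n)
variance-bound (suc (suc n)) = variance-step n (variance-bound n) (variance-bound (suc n))

-- Chebyshev's inequality and the largest layer

∣m-n∣²+2mn≡m²+n² : ∀ m n → ∣ m - n ∣ * ∣ m - n ∣ + 2 * (m * n) ≡ m * m + n * n
∣m-n∣²+2mn≡m²+n² zero n = +-identityʳ (n * n)
∣m-n∣²+2mn≡m²+n² (suc m) zero = cong (suc m * suc m +_) (cong (2 *_) (*-zeroʳ m))
∣m-n∣²+2mn≡m²+n² (suc m) (suc n) = begin
    ∣ m - n ∣ * ∣ m - n ∣ + 2 * (suc m * suc n)                      ≡⟨ lemma₁ (∣ m - n ∣ * ∣ m - n ∣) m n ⟩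
    ∣ m - n ∣ * ∣ m - n ∣ + 2 * (m * n) + (2 * m + 2 * n + 2)        ≡⟨ cong (_+ (2 * m + 2 * n + 2)) (∣m-n∣²+2mn≡m²+n² m n) ⟩
    m * m + n * n + (2 * m + 2 * n + 2)                              ≡⟨ lemma₂ m n ⟩
    suc m * suc m + suc n * suc n                                    ∎
  where
  open ≡-Reasoning
  lemma₁ : ∀ d m n → d + 2 * (suc m * suc n) ≡ d + 2 * (m * n) + (2 * m + 2 * n + 2)
  lemma₁ = solve-∀
  lemma₂ : ∀ m n → m * m + n * n + (2 * m + 2 * n + 2) ≡ suc m * suc m + suc n * suc n
  lemma₂ = solve-∀

-- total n times the distance from k to the mean size, to stay in ℕ.
deviation : ℕ → ℕ → ℕ
deviation n k = ∣ total n * k - moment₁ n ∣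

-- Expanding the square turns the sum into `T * (T * S - M * M)`, and `variance-bound` controls the
-- bracket. The cross term is added to both sides to avoid subtraction.
deviation² : ∀ n → sizeSum n (λ k → deviation n k * deviation n k) ≤ n * (total n * (total n * total n))
deviation² n = +-cancelʳ-≤ (2 * (T * M * M)) _ _ (begin
    sizeSum n (λ k → d k * d k) + 2 * (T * M * M)
      ≡⟨ cong (sizeSum n (λ k → d k * d k) +_) (lemma₁ T M) ⟩
    sizeSum n (λ k → d k * d k) + 2 * T * M * M
      ≡⟨ cong (sizeSum n (λ k → d k * d k) +_) (sym (sizeSum-* n (2 * T * M) (λ k → k))) ⟩
    sizeSum n (λ k → d k * d k) + sizeSum n (λ k → 2 * T * M * k)
      ≡⟨ sym (sizeSum-+ n (λ k → d k * d k) (λ k → 2 * T * M * k)) ⟩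
    sizeSum n (λ k → d k * d k + 2 * T * M * k)
      ≡⟨ sizeSum-cong n (λ k → trans (cong (d k * d k +_) (lemma₂ T M k))
           (trans (∣m-n∣²+2mn≡m²+n² (T * k) M) (lemma₃ T M k))) ⟩
    sizeSum n (λ k → T * T * (k * k) + M * M * 1)
      ≡⟨ sizeSum-+ n (λ k → T * T * (k * k)) (λ _ → M * M * 1) ⟩
    sizeSum n (λ k → T * T * (k * k)) + sizeSum n (λ _ → M * M * 1)
      ≡⟨ cong₂ _+_ (sizeSum-* n (T * T) (λ k → k * k)) (sizeSum-* n (M * M) (λ _ → 1)) ⟩
    T * T * S + M * M * T
      ≡⟨ cong (_+ M * M * T) (*-assoc T T S) ⟩
    T * (T * S) + M * M * T
      ≤⟨ +-monoˡ-≤ (M * M * T) (*-monoʳ-≤ T (variance-bound n)) ⟩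
    T * (M * M + n * (T * T)) + M * M * T
      ≡⟨ lemma₄ T M n ⟩
    n * (T * (T * T)) + 2 * (T * M * M) ∎)
  where
  open ≤-Reasoning
  T = total n
  M = moment₁ n
  S = moment₂ n
  d = deviation n
  lemma₁ : ∀ T M → 2 * (T * M * M) ≡ 2 * T * M * M
  lemma₁ = solve-∀
  lemma₂ : ∀ T M k → 2 * T * M * k ≡ 2 * (T * k * M)
  lemma₂ = solve-∀
  lemma₃ : ∀ T M k → T * k * (T * k) + M * M ≡ T * T * (k * k) + M * M * 1
  lemma₃ = solve-∀
  lemma₄ : ∀ T M n → T * (M * M + n * (T * T)) + M * M * T ≡ n * (T * (T * T)) + 2 * (T * M * M)
  lemma₄ = solve-∀

windowSum : (ℕ → ℕ → ℕ) → ℕ → ℕ → ℕ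
windowSum g zero k = 0
windowSum g (suc w) k = g w k + windowSum g w k

sizeSum-window : ∀ n g m w → (∀ i → sizeSum n (g i) ≤ m) → sizeSum n (windowSum g w) ≤ w * m
sizeSum-window n g m zero le = ≤-reflexive (sizeSum-vanish n _ (λ _ _ → refl))
sizeSum-window n g m (suc w) le = ≤-trans (≤-reflexive (sizeSum-+ n (g w) (windowSum g w)))
  (+-mono-≤ (le w) (sizeSum-window n g m w le))

windowSum-≥ : ∀ g {w i k} → i < w → g i k ≤ windowSum g w k
windowSum-≥ g {suc w} {i} {k} i<1+w with i ≟ w
... | yes refl = m≤m+n _ _
... | no i≢w = ≤-trans (windowSum-≥ g (≤∧≢⇒< (s≤s⁻¹ i<1+w) i≢w)) (m≤n+m _ (g w k))

indicator-refl : ∀ k → indicator (k ≡ᵇ k) ≡ 1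
indicator-refl zero = refl
indicator-refl (suc k) = indicator-refl k

-- If T k lies within t T of M then k lies in the window of 2t consecutive integers ending at M / T + t.
near-mean : ∀ T .{{_ : NonZero T}} M t k → ∣ T * k - M ∣ < t * T →
            ∃ λ i → (i < t + t) × (k ≡ suc (M / T + i) ∸ t)
near-mean T M t k close = i , +-cancelˡ-< (suc q) i (t + t) i-small , sym k-eq
  where
  open ≤-Reasoning
  q = M / T
  M<[1+q]T : M < suc q * T
  M<[1+q]T = begin-strict
    M                ≡⟨ m≡m%n+[m/n]*n M T ⟩
    M % T + q * T    <⟨ +-monoˡ-< (q * T) (m%n<n M T) ⟩
    suc q * T        ∎
  qT≤M : q * T ≤ M
  qT≤M = ≤-trans (m≤n+m (q * T) (M % T)) (≤-reflexive (sym (m≡m%n+[m/n]*n M T)))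
  below : q < k + t
  below = *-cancelʳ-< T q (k + t) (begin-strict
    q * T                       ≤⟨ qT≤M ⟩
    M                           ≤⟨ m≤n+∣n-m∣ M (T * k) ⟩
    T * k + ∣ T * k - M ∣       <⟨ +-monoʳ-< (T * k) close ⟩
    T * k + t * T               ≡⟨ cong (_+ t * T) (*-comm T k) ⟩
    k * T + t * T               ≡⟨ sym (*-distribʳ-+ T k t) ⟩
    (k + t) * T                 ∎)
  above : k < suc q + t
  above = *-cancelʳ-< T k (suc q + t) (begin-strict
    k * T                       ≡⟨ *-comm k T ⟩
    T * k                       ≤⟨ m≤n+∣m-n∣ (T * k) M ⟩
    M + ∣ T * k - M ∣           <⟨ +-mono-< M<[1+q]T close ⟩
    suc q * T + t * T           ≡⟨ sym (*-distribʳ-+ T (suc q) t) ⟩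
    (suc q + t) * T             ∎)
  i = k + t ∸ suc q
  1+q+i≡k+t : suc q + i ≡ k + t
  1+q+i≡k+t = m+[n∸m]≡n below
  i-small : suc q + i < suc q + (t + t)
  i-small = begin-strict
    suc q + i        ≡⟨ 1+q+i≡k+t ⟩
    k + t            <⟨ +-monoˡ-< t above ⟩
    suc q + t + t    ≡⟨ +-assoc (suc q) t t ⟩
    suc q + (t + t)  ∎
  k-eq : suc (q + i) ∸ t ≡ k
  k-eq = trans (cong (_∸ t) 1+q+i≡k+t) (m+n∸n≡m k t)

-- Chebyshev: the variance is at most n, hence at most t² / 2, so at most half of the sets have size
-- t or more away from the mean. The others lie in a window of 2 t layers.
total≤window : ∀ n t → .{{NonZero t}} → 2 * n ≤ t * t → total n ≤ 4 * t * maxLayer n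
total≤window n t 2n≤t² = +-cancelʳ-≤ T T (4 * t * m) (begin
    T + T                                   ≡⟨ cong (T +_) (sym (+-identityʳ T)) ⟩
    2 * T                                   ≤⟨ *-monoʳ-≤ 2 split ⟩
    2 * (sizeSum n (windowSum δ (t + t)) + sizeSum n bad)
                                            ≤⟨ *-monoʳ-≤ 2 (+-monoˡ-≤ _ (sizeSum-window n δ m (t + t) (λ i → layer≤maxLayer n (suc (q + i) ∸ t)))) ⟩
    2 * ((t + t) * m + sizeSum n bad)       ≡⟨ lemma₁ t m (sizeSum n bad) ⟩
    4 * t * m + 2 * sizeSum n bad           ≤⟨ +-monoʳ-≤ (4 * t * m) few-bad ⟩
    4 * t * m + T                           ∎)
  where
  open ≤-Reasoning
  T = total n
  M = moment₁ n
  m = maxLayer n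
  instance
    T≢0 : NonZero T
    T≢0 = >-nonZero (total-positive n)
    t²T²≢0 : NonZero (t * t * (T * T))
    t²T²≢0 = m*n≢0 (t * t) (T * T) {{m*n≢0 t t}} {{m*n≢0 T T}}
  q = M / T
  δ : ℕ → ℕ → ℕ
  δ i k = indicator (k ≡ᵇ (suc (q + i) ∸ t))
  bad : ℕ → ℕ
  bad k = indicator (t * T ≤ᵇ deviation n k)
  lemma₁ : ∀ t m b → 2 * ((t + t) * m + b) ≡ 4 * t * m + 2 * b
  lemma₁ = solve-∀
  lemma₂ : ∀ t T b → t * t * (T * T) * (2 * b) ≡ 2 * (t * T * (t * T) * b)
  lemma₂ = solve-∀
  lemma₃ : ∀ n T → 2 * (n * (T * (T * T))) ≡ 2 * n * (T * (T * T))
  lemma₃ = solve-∀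
  lemma₄ : ∀ t T → t * t * (T * (T * T)) ≡ t * t * (T * T) * T
  lemma₄ = solve-∀
  -- Markov's inequality, pointwise before summation.
  bad-≤ : ∀ k → t * T * (t * T) * bad k ≤ deviation n k * deviation n k
  bad-≤ k with t * T ≤ᵇ deviation n k in eq
  ... | false = ≤-trans (≤-reflexive (*-zeroʳ (t * T * (t * T)))) z≤n
  ... | true = ≤-trans (≤-reflexive (*-identityʳ _)) (*-mono-≤ tT≤d tT≤d)
    where
    tT≤d : t * T ≤ deviation n k
    tT≤d = ≤ᵇ⇒≤ (t * T) _ (subst IsTrue (sym eq) _)
  few-bad : 2 * sizeSum n bad ≤ T
  few-bad = *-cancelˡ-≤ (t * t * (T * T)) (begin
    t * t * (T * T) * (2 * sizeSum n bad)                     ≡⟨ lemma₂ t T (sizeSum n bad) ⟩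
    2 * (t * T * (t * T) * sizeSum n bad)                     ≡⟨ cong (2 *_) (sym (sizeSum-* n (t * T * (t * T)) bad)) ⟩
    2 * sizeSum n (λ k → t * T * (t * T) * bad k)             ≤⟨ *-monoʳ-≤ 2 (sizeSum-mono n bad-≤) ⟩
    2 * sizeSum n (λ k → deviation n k * deviation n k)       ≤⟨ *-monoʳ-≤ 2 (deviation² n) ⟩
    2 * (n * (T * (T * T)))                                   ≡⟨ lemma₃ n T ⟩
    2 * n * (T * (T * T))                                     ≤⟨ *-monoˡ-≤ (T * (T * T)) 2n≤t² ⟩
    t * t * (T * (T * T))                                     ≡⟨ lemma₄ t T ⟩
    t * t * (T * T) * T                                       ∎)
  near-or-bad : ∀ k → 1 ≤ windowSum δ (t + t) k + bad k
  near-or-bad k with t * T ≤ᵇ deviation n k in eq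
  ... | true = m≤n+m 1 _
  ... | false with near-mean T M t k (≰⇒> (λ le → subst IsTrue eq (≤⇒≤ᵇ le)))
  ...   | i , i<2t , refl = ≤-trans (≤-reflexive (sym (indicator-refl k)))
            (≤-trans (windowSum-≥ δ i<2t) (m≤m+n _ 0))
  split : T ≤ sizeSum n (windowSum δ (t + t)) + sizeSum n bad
  split = ≤-trans (sizeSum-mono n near-or-bad) (≤-reflexive (sizeSum-+ n (windowSum δ (t + t)) bad))

-- Combining the two bounds

total≡fib : ∀ n → total n ≡ fib (2 + n)
total≡fib zero = refl
total≡fib (suc zero) = refl
total≡fib (suc (suc n)) = cong₂ _+_ (total≡fib (suc n)) (total≡fib n)

-- s is the integer part of √(n / 16), the largest value that `antichain-bound` admits.
sqrt-16 : ∀ n → ∃ λ s → (16 * (s * s) ≤ n) × (n < 16 * (suc s * suc s))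
sqrt-16 zero = 0 , z≤n , s≤s z≤n
sqrt-16 (suc n) with sqrt-16 n
... | s , lower , upper with suc n <? 16 * (suc s * suc s)
...   | yes upper′ = s , m≤n⇒m≤1+n lower , upper′
...   | no ¬upper′ = suc s , ≮⇒≥ ¬upper′ , ≤-<-trans upper
          (*-monoʳ-< 16 (*-mono-< (n<1+n (suc s)) (n<1+n (suc s))))

antichain≤maxLayer : ∀ n (F : List (Subset n)) → Unique F → InQ F → Antichain F → length F ≤ 288 * maxLayer n
antichain≤maxLayer n F unique inQ antichain with sqrt-16 n
... | s , lower , upper = *-cancelˡ-≤ (suc s) (begin
    suc s * length F                         ≤⟨ antichain-bound s n lower F unique inQ antichain ⟩
    12 * fib (2 + n)                         ≡⟨ cong (12 *_) (sym (total≡fib n)) ⟩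
    -- The window t = 6 (s + 1) is wide enough because 2 n is below 32 (s + 1)², hence below t². The
    -- factor s + 1 then cancels, leaving 288 = 12 * 4 * 6.
    12 * total n                             ≤⟨ *-monoʳ-≤ 12 (total≤window n (6 * suc s) 2n≤t²) ⟩
    12 * (4 * (6 * suc s) * maxLayer n)      ≡⟨ lemma₁ (suc s) (maxLayer n) ⟩
    suc s * (288 * maxLayer n)               ∎)
  where
  open ≤-Reasoning
  lemma₁ : ∀ t m → 12 * (4 * (6 * t) * m) ≡ t * (288 * m)
  lemma₁ = solve-∀
  lemma₂ : ∀ t → 2 * (16 * (t * t)) + 4 * (t * t) ≡ 6 * t * (6 * t)
  lemma₂ = solve-∀
  2n≤t² : 2 * n ≤ 6 * suc s * (6 * suc s)
  2n≤t² = begin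
    2 * n                                                 ≤⟨ *-monoʳ-≤ 2 (<⇒≤ upper) ⟩
    2 * (16 * (suc s * suc s))                            ≤⟨ m≤m+n _ (4 * (suc s * suc s)) ⟩
    2 * (16 * (suc s * suc s)) + 4 * (suc s * suc s)      ≡⟨ lemma₂ (suc s) ⟩
    6 * suc s * (6 * suc s)                               ∎

theorem3 : Σ ℕ (λ C → (1 < C) × ((n : ℕ) → (F : List (Subset n)) →
    Unique F → InQ F → Antichain F → length F ≤ C * maxLayer n))
theorem3 = 288 , s≤s (s≤s z≤n) , antichain≤maxLayer
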